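{- Let $X$ be a non-empty set, let $S,T\subseteq\mathrm{Der}(X)$ be non-empty, let $\Gamma=\overrightarrow{\mathrm{DA}}(X,S)$ and $\Delta=\overrightarrow{\mathrm{DA}}(X,T)$, and let $g\in\mathrm{Sym}(X)$. (a) Then $g$ is an isomorphism from $\Gamma$ to $\Delta$ if and only if $x^{S^g}=x^T$ for all $x\in X$. (b) $\mathrm{Aut}(\Gamma)=\{h\in\mathrm{Sym}(X) : x^S=x^{S^h}\text{ for all } x\in X\}$, and in particular $\mathrm{Aut}(\Gamma)$ contains $N_{\mathrm{Sym}(X)}(S)=\{h\in\mathrm{Sym}(X): S^h=S\}$.
   Context: For a set $X$, $\mathrm{Sym}(X)$ is the group of all permutations of $X$, acting on the right: $x^s$ is the image of $x$ under $s$, and $x^{st}=(x^s)^t$. A derangement of $X$ is a permutation of $X$ with no fixed points; $\mathrm{Der}(X)$ is the set of derangements of $X$. For $S\subseteq\mathrm{Sym}(X)$, $g\in\mathrm{Sym}(X)$ and $x\in X$, write $S^g=g^{ -1}Sg=\{g^{ -1}sg: s\in S\}$ and $x^S=\{x^s: s\in S\}$. A simple digraph is a pair $(X,A)$ with vertex set $X$ and arc set $A\subseteq\{(u,v): u,v\in X, u\neq v\}$. For non-empty $X$ and non-empty $S\subseteq \mathrm{Der}(X)$, the derangement action digraph $\overrightarrow{\mathrm{DA}}(X,S)$ is the simple digraph with vertex set $X$ and arc set $\{(x,x^s): x\in X, s\in S\}$. For simple digraphs $(X,A)$ and $(X,B)$ on the same vertex set, an isomorphism from $(X,A)$ to $(X,B)$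 is an element $g\in\mathrm{Sym}(X)$ with $A^g=B$, where $A^g=\{(u^g,v^g): (u,v)\in A\}$. An automorphism is an isomorphism from a digraph to itself, and $\mathrm{Aut}(\Gamma)$ is the group of automorphisms of $\Gamma$. -}

module Defs where

open import Level using (Level; _⊔_)
open import Algebra.Bundles using (Group)
open import Data.Product using (_×_; _,_; ∃; ∃₂)
open import Function.Bundles using (_↔_; Inverse)
open import Function.Properties.Inverse using (↔-refl; ↔-sym; ↔-trans)
open import Relation.Binary.PropositionalEquality
  using (_≡_; _≢_; refl; sym; trans; cong)
open import Relation.Unary using (Pred; _∈_; _⊆_; _≐_)

private
  variable
    a ℓ ℓ₁ ℓ₂ : Level
    X : Set a

infixl 8 _^_ _^ᶜ_ _^ˢ_ _^ᴬ_

Perm : Set a → Set a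
Perm X = X ↔ X

_^_ : X → Perm X → X
x ^ s = Inverse.to s x

-- The operation is ↔-trans rather than function composition because
-- permutations act on the right: x ^ (s ∙ t) = (x ^ s) ^ t.  Equality of
-- permutations is pointwise equality of the underlying maps.
Sym : Set a → Group a a
Sym X = record
  { Carrier = Perm X
  ; _≈_     = λ s t → ∀ x → x ^ s ≡ x ^ t
  ; _∙_     = ↔-trans
  ; ε       = ↔-refl
  ; _⁻¹     = ↔-sym
  ; isGroup = record
    { isMonoid = record
      { isSemigroup = record
        { isMagma = record
          { isEquivalence = record
            { refl  = λ x → refl
            ; sym   = λ s≈t x → sym (s≈t x)
            ; trans = λ s≈t t≈u x → trans (s≈t x) (t≈u x)
            }
          ; ∙-cong = λ {_} {t} {u} s≈t u≈v x →
              trans (cong (_^ u) (s≈t x)) (u≈v (x ^ t))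
          }
        ; assoc = λ s t u x → refl
        }
      ; identity = (λ s x → refl) , (λ s x → refl)
      }
    ; inverse = Inverse.strictlyInverseˡ , Inverse.strictlyInverseʳ
    ; ⁻¹-cong = λ {s} {t} s≈t x →
        trans (cong (Inverse.from s)
                (trans (sym (Inverse.strictlyInverseˡ t x))
                       (sym (s≈t (Inverse.from t x)))))
              (Inverse.strictlyInverseʳ s (Inverse.from t x))
    }
  }

module _ {X : Set a} where
  open Group (Sym X) using (_≈_; _∙_; _⁻¹) public

Der : (X : Set a) → Pred (Perm X) a
Der X s = ∀ x → x ^ s ≢ x

-- The conjugate S^g.  A subset of Sym X is a predicate on permutations that
-- respects _≈_, so the image of S under conjugation is closed under _≈_.
_^ᶜ_ : {X : Set a} → Pred (Perm X) ℓ → Perm X → Pred (Perm X) (a ⊔ ℓ)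
(S ^ᶜ g) t = ∃ λ s → s ∈ S × t ≈ (g ⁻¹ ∙ s ∙ g)

_^ˢ_ : {X : Set a} → X → Pred (Perm X) ℓ → Pred X (a ⊔ ℓ)
(x ^ˢ S) y = ∃ λ s → s ∈ S × y ≡ x ^ s

Normaliser : {X : Set a} → Pred (Perm X) ℓ → Pred (Perm X) (a ⊔ ℓ)
Normaliser S h = S ^ᶜ h ≐ S

record SimpleDigraph (X : Set a) ℓ : Set (a ⊔ Level.suc ℓ) where
  field
    Arc    : Pred (X × X) ℓ
    simple : ∀ {u v} → (u , v) ∈ Arc → u ≢ v

open SimpleDigraph public

DA : {X : Set a} (S : Pred (Perm X) ℓ) → S ⊆ Der X → SimpleDigraph X (a ⊔ ℓ)
DA S S⊆Der = record
  { Arc    = λ p → ∃₂ λ x s → s ∈ S × p ≡ (x , x ^ s)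
  ; simple = λ { (x , s , s∈S , refl) x≡xˢ → S⊆Der s∈S x (sym x≡xˢ) }
  }

_^ᴬ_ : {X : Set a} → Pred (X × X) ℓ → Perm X → Pred (X × X) (a ⊔ ℓ)
(A ^ᴬ g) p = ∃₂ λ u v → (u , v) ∈ A × p ≡ (u ^ g , v ^ g)

IsIsomorphism : {X : Set a} → SimpleDigraph X ℓ₁ → SimpleDigraph X ℓ₂ →
                Pred (Perm X) (a ⊔ ℓ₁ ⊔ ℓ₂)
IsIsomorphism Γ Δ g = Arc Γ ^ᴬ g ≐ Arc Δ

Aut : {X : Set a} → SimpleDigraph X ℓ → Pred (Perm X) (a ⊔ ℓ)
Aut Γ = IsIsomorphism Γ Γ

{-# OPTIONS --safe #-}

-- The out-neighbours of x in DA(X, S) form x^S, and conjugating the arc set by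
-- g conjugates S by g.  So both arc sets compared in A^g = B are determined by
-- their out-neighbourhoods x^(S^g) and x^T.
module Submission where

open import Level using (Level)
open import Defs
open import Data.Product using (_×_; _,_; proj₁; proj₂)
open import Function.Bundles using (_⇔_; mk⇔; Equivalence; Inverse)
open import Relation.Binary.Definitions using (_Respects_)
open import Relation.Binary.PropositionalEquality using (refl; sym; cong; cong₂)
open import Relation.Unary using (Pred; _∈_; _⊆_; _≐_; Satisfiable)
open import Relation.Unary.Properties using (≐-sym)

module _ {a ℓ : Level} {X : Set a} where

  ^ˢ-mono : ∀ {ℓ′} {S : Pred (Perm X) ℓ} {T : Pred (Perm X) ℓ′} →
            S ⊆ T → ∀ x → x ^ˢ S ⊆ x ^ˢ T
  ^ˢ-mono S⊆T x (s , s∈S , y≡xˢ) = s , S⊆T s∈S , y≡xˢ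

  module _ (S : Pred (Perm X) ℓ) (S⊆Der : S ⊆ Der X) where

    arc⇔ : ∀ {x y} → (x , y) ∈ Arc (DA S S⊆Der) ⇔ y ∈ x ^ˢ S
    arc⇔ = mk⇔ (λ { (_ , s , s∈S , refl) → s , s∈S , refl })
               (λ { (s , s∈S , refl) → _ , s , s∈S , refl })

    -- An arc `(u , u ^ s)` is carried by `g` to `(u ^ g , u ^ s ^ g)`. Writing the tail as `x`, so
    -- that `u` is `x ^ (g ⁻¹)`, turns the head into the image of `x` under `g ⁻¹ ∙ s ∙ g`.
    arc-conj⇔ : ∀ g {x y} →
                (x , y) ∈ Arc (DA S S⊆Der) ^ᴬ g ⇔ y ∈ x ^ˢ (S ^ᶜ g)
    arc-conj⇔ g {x} = mk⇔
      (λ { (_ , _ , (u , s , s∈S , refl) , refl) →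
           g ⁻¹ ∙ s ∙ g , (s , s∈S , λ _ → refl) ,
           cong (λ z → z ^ s ^ g) (sym (Inverse.strictlyInverseʳ g u)) })
      (λ { (t , (s , s∈S , t≈sᵍ) , refl) →
           -- The preimage arc must start at `x ^ (g ⁻¹)`. Since `t` agrees with the conjugate of
           -- `s` only pointwise, the heads are compared at `x`.
           _ , _ , (x ^ (g ⁻¹) , s , s∈S , refl) ,
           cong₂ _,_ (sym (Inverse.strictlyInverseˡ g x)) (t≈sᵍ x) })

-- Two sets of pairs coincide exactly when their fibres over every first coordinate do.
isomorphism⇔ : ∀ {a ℓ₁ ℓ₂} {X : Set a}
  (S : Pred (Perm X) ℓ₁) (S⊆Der : S ⊆ Der X) →
  (T : Pred (Perm X) ℓ₂) (T⊆Der : T ⊆ Der X) → ∀ g →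
  g ∈ IsIsomorphism (DA S S⊆Der) (DA T T⊆Der) ⇔ (∀ x → x ^ˢ (S ^ᶜ g) ≐ x ^ˢ T)
isomorphism⇔ S S⊆Der T T⊆Der g = mk⇔ sameImages isomorphism
  where
  module Aᵍ {x y} = Equivalence (arc-conj⇔ S S⊆Der g {x} {y})
  module B {x y} = Equivalence (arc⇔ T T⊆Der {x} {y})

  sameImages : g ∈ IsIsomorphism (DA S S⊆Der) (DA T T⊆Der) →
               ∀ x → x ^ˢ (S ^ᶜ g) ≐ x ^ˢ T
  sameImages (Aᵍ⊆B , B⊆Aᵍ) x =
    (λ y∈xˢᵍ → B.to (Aᵍ⊆B (Aᵍ.from y∈xˢᵍ))) ,
    (λ y∈xᵀ → Aᵍ.to (B⊆Aᵍ (B.from y∈xᵀ)))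

  isomorphism : (∀ x → x ^ˢ (S ^ᶜ g) ≐ x ^ˢ T) →
                g ∈ IsIsomorphism (DA S S⊆Der) (DA T T⊆Der)
  isomorphism same =
    (λ {(x , _)} p∈Aᵍ → B.from (proj₁ (same x) (Aᵍ.to p∈Aᵍ))) ,
    (λ {(x , _)} p∈B → Aᵍ.from (proj₂ (same x) (B.to p∈B)))

theorem1p15 :
    ∀ {a ℓ₁ ℓ₂} (X : Set a) → X →
    (S : Pred (Perm X) ℓ₁) → S Respects _≈_ → Satisfiable S → (S⊆Der : S ⊆ Der X) →
    (T : Pred (Perm X) ℓ₂) → T Respects _≈_ → Satisfiable T → (T⊆Der : T ⊆ Der X) →
    (g : Perm X) →
    let Γ = DA S S⊆Der
        Δ = DA T T⊆Der
    in (g ∈ IsIsomorphism Γ Δ ⇔ (∀ x → x ^ˢ (S ^ᶜ g) ≐ x ^ˢ T))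
       × (Aut Γ ≐ λ h → ∀ x → x ^ˢ S ≐ x ^ˢ (S ^ᶜ h))
       × (Normaliser S ⊆ Aut Γ)
theorem1p15 X _ S _ _ S⊆Der T _ _ T⊆Der g =
  isomorphism⇔ S S⊆Der T T⊆Der g ,
  -- The criterion puts the conjugated set on the left, part (b) on the right.
  ((λ {h} h∈Aut x → ≐-sym (to h h∈Aut x)) ,
   (λ {h} same → from h (λ x → ≐-sym (same x)))) ,
  -- Equal sets of permutations move each point to equal sets of images, so the criterion applies.
  (λ {h} (Sʰ⊆S , S⊆Sʰ) → from h (λ x → ^ˢ-mono Sʰ⊆S x , ^ˢ-mono S⊆Sʰ x))
  where
  -- The case where `T` is `S`: part (a) becomes a membership criterion for `Aut Γ`.
  open module Automorphism h = Equivalence (isomorphism⇔ S S⊆Der S S⊆Der h)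
    using (to; from)
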